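{- Let $n\ge 2$ be an integer and let $G$ be a simple graph. Then $G$ is isomorphic to the path $P_n$ on $n$ vertices if and only if $$da(G;x,y) = 2xy^{n-1} + (n-2)xy^{n-2} + y^{n}\sum_{i=2}^{n-1}(n-i+1)x^{i} + x^{n}y^{n+1}.$$
   Context: All graphs are finite, simple and have at least one vertex. For a graph $G$, $S\subseteq V(G)$ and $u\in V(G)$, let $\bar S=V(G)\setminus S$, let $\delta_S(u)=|\{v\in S:\{u,v\}\in E(G)\}|$, and let $G[S]$ be the subgraph induced by $S$. The defensive alliance polynomial of $G$ is $$da(G;x,y)=\sum_{S} x^{|S|}\,y^{f_y(S)},\qquad f_y(S)=\min_{u\in S}\bigl(\delta_S(u)-\delta_{\bar S}(u)+|V(G)|\bigr),$$ where the sum runs over all non-empty $S\subseteq V(G)$ such that $G[S]$ is connected (single-vertex graphs are connected). -}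

module Defs where

open import Data.Bool using (if_then_else_; _∧_)
open import Data.Fin using (Fin; zero; suc; toℕ)
import Data.Fin.Properties as Fin
open import Data.Fin.Subset using (Subset; inside; outside; _∈_; _∩_; ∁; ∣_∣; Nonempty)
open import Data.Fin.Subset.Properties using (nonempty?; ∣p∣≤n)
import Data.Integer as ℤ
import Data.Integer.Properties as ℤ
open import Data.List using (List; []; _∷_; _++_; map; cartesianProductWith; foldr; upTo)
open import Data.List.Extrema.Nat using (min)
open import Data.List.Membership.Propositional using () renaming (_∈_ to _∈ˡ_)
open import Data.List.Membership.Propositional.Properties using (∈-map⁺)
open import Data.List.Relation.Unary.All as All using (all?)
open import Data.List.Relation.Unary.Any as Any using ()
open import Data.Nat using (ℕ; zero; suc; _+_; _*_; _∸_; _≟_)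
open import Data.Nat.ListAction using (sum)
import Data.Nat.Properties as ℕ
open import Data.Product using (∃; _×_; _,_; proj₁; proj₂)
open import Data.Product.Properties using (≡-dec)
open import Data.Sum using (_⊎_; inj₁; inj₂; swap)
open import Data.Vec using ([]; _∷_; tabulate; here; there)
open import Data.Vec.Properties.WithK using ([]=-irrelevant)
open import Function using (_∘_; _↔_; _⇔_; Inverse)
open import Relation.Binary using (Rel; Decidable; DecidableEquality; Symmetric; Irreflexive)
open import Relation.Binary.Construct.Closure.ReflexiveTransitive using (Star; ε; _◅_; _◅◅_)
open import Relation.Binary.PropositionalEquality using (_≡_; refl; cong; module ≡-Reasoning)
open import Relation.Nullary using (Dec; yes; no; does; _×-dec_; _⊎-dec_)
import Relation.Nullary.Decidable as Dec
open import Level using (0ℓ)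

-- A polynomial is a formal sum of terms (c , i , j), standing for c xⁱ yʲ; two
-- formal sums are the same polynomial (_≈ₚ_) when all their coefficients agree.
-- Coefficients are natural numbers: none is negative here, and ℕ[x,y]
-- embeds in ℤ[x,y].

Poly : Set
Poly = List (ℕ × ℕ × ℕ)

coeff : Poly → ℕ → ℕ → ℕ
coeff p i j = sum (map (λ (c , a , b) → if does (a ≟ i) ∧ does (b ≟ j) then c else 0) p)

infix 4 _≈ₚ_
_≈ₚ_ : Rel Poly 0ℓ
p ≈ₚ q = ∀ i j → coeff p i j ≡ coeff q i j

const : ℕ → Poly
const c = (c , 0 , 0) ∷ []

x y : Poly
x = (1 , 1 , 0) ∷ []
y = (1 , 0 , 1) ∷ []

infixl 6 _+ₚ_
_+ₚ_ : Poly → Poly → Poly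
_+ₚ_ = _++_

infixl 7 _*ₚ_
_*ₚ_ : Poly → Poly → Poly
_*ₚ_ = cartesianProductWith λ (c , i , j) (d , k , l) → c * d , i + k , j + l

infixr 8 _^ₚ_
_^ₚ_ : Poly → ℕ → Poly
p ^ₚ zero  = const 1
p ^ₚ suc k = p *ₚ p ^ₚ k

∑ : {A : Set} → List A → (A → Poly) → Poly
∑ as f = foldr (λ a p → f a +ₚ p) (const 0) as

-- Inclusive at both ends, and empty when b < a.
[_⋯_] : ℕ → ℕ → List ℕ
[ a ⋯ b ] = map (a +_) (upTo (suc b ∸ a))

-- Adjacency is decidable so that the sum defining da can be formed.
record Graph (n : ℕ) : Set₁ where
  field
    Adj    : Rel (Fin n) 0ℓ
    adj?   : Decidable Adj
    symm   : Symmetric Adj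
    irrefl : Irreflexive _≡_ Adj

open Graph public

record _≅_ {m n : ℕ} (G : Graph m) (H : Graph n) : Set where
  field
    bijection : Fin m ↔ Fin n
    preserves : ∀ u v → Adj G u v ⇔ Adj H (Inverse.to bijection u) (Inverse.to bijection v)

infix 4 _≅_

path : ∀ n → Graph n
path n = record
  { Adj    = λ u v → suc (toℕ u) ≡ toℕ v ⊎ suc (toℕ v) ≡ toℕ u
  ; adj?   = λ u v → (suc (toℕ u) ≟ toℕ v) ⊎-dec (suc (toℕ v) ≟ toℕ u)
  ; symm   = swap
  ; irrefl = λ { refl (inj₁ e) → ℕ.1+n≢n e ; refl (inj₂ e) → ℕ.1+n≢n e }
  }

Connected : {V : Set} → Rel V 0ℓ → Set
Connected R = ∀ u v → Star R u v

Induced : ∀ {n} → Graph n → (S : Subset n) → Rel (∃ (_∈ S)) 0ℓ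
Induced G S u v = Adj G (proj₁ u) (proj₁ v)

module _ {V : Set} {R : Rel V 0ℓ} (_≟ⱽ_ : DecidableEquality V) (R? : Decidable R) where

  -- Walks whose intermediate vertices all lie in the list (as in the
  -- Floyd–Warshall algorithm).
  Via : List V → Rel V 0ℓ
  Via []       u v = u ≡ v ⊎ R u v
  Via (w ∷ ws) u v = Via ws u v ⊎ (Via ws u w × Via ws w v)

  via? : ∀ ws → Decidable (Via ws)
  via? []       u v = (u ≟ⱽ v) ⊎-dec R? u v
  via? (w ∷ ws) u v = via? ws u v ⊎-dec (via? ws u w ×-dec via? ws w v)

  via⇒star : ∀ ws {u v} → Via ws u v → Star R u v
  via⇒star []       (inj₁ refl)    = ε
  via⇒star []       (inj₂ r)       = r ◅ ε
  via⇒star (w ∷ ws) (inj₁ p)       = via⇒star ws p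
  via⇒star (w ∷ ws) (inj₂ (p , q)) = via⇒star ws p ◅◅ via⇒star ws q

  via-refl : ∀ ws {u} → Via ws u u
  via-refl []       = inj₁ refl
  via-refl (w ∷ ws) = inj₁ (via-refl ws)

  via-step : ∀ ws {u v} → R u v → Via ws u v
  via-step []       r = inj₂ r
  via-step (w ∷ ws) r = inj₁ (via-step ws r)

  via-join : ∀ ws {u w v} → w ∈ˡ ws → Via ws u w → Via ws w v → Via ws u v
  via-join (w ∷ ws) (Any.here refl) p q = inj₂ (to p , from q)
    where
    to : ∀ {u} → Via (w ∷ ws) u w → Via ws u w
    to (inj₁ p)       = p
    to (inj₂ (p , _)) = p
    from : ∀ {v} → Via (w ∷ ws) w v → Via ws w v
    from (inj₁ q)       = q
    from (inj₂ (_ , q)) = q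
  via-join (_ ∷ ws) (Any.there i) (inj₁ p) (inj₁ q) = inj₁ (via-join ws i p q)
  via-join (_ ∷ ws) (Any.there i) (inj₁ p) (inj₂ (q , r)) = inj₂ (via-join ws i p q , r)
  via-join (_ ∷ ws) (Any.there i) (inj₂ (p , q)) (inj₁ r) = inj₂ (p , via-join ws i q r)
  via-join (_ ∷ ws) (Any.there i) (inj₂ (p , _)) (inj₂ (_ , r)) = inj₂ (p , r)

  module _ (vs : List V) (complete : ∀ v → v ∈ˡ vs) where

    star⇒via : ∀ {u v} → Star R u v → Via vs u v
    star⇒via ε        = via-refl vs
    star⇒via (r ◅ rs) = via-join vs (complete _) (via-step vs r) (star⇒via rs)

    star? : Decidable (Star R)
    star? u v = Dec.map′ (via⇒star vs) star⇒via (via? vs u v)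

    connected? : Dec (Connected R)
    connected? = Dec.map′
      (λ c u v → All.lookup (All.lookup c (complete u)) (complete v))
      (λ c → All.tabulate λ {u} _ → All.tabulate λ {v} _ → c u v)
      (all? (λ u → all? (star? u) vs) vs)

elements : ∀ {n} (S : Subset n) → List (∃ (_∈ S))
elements []            = []
elements (inside  ∷ S) = (zero , here) ∷ map (λ (u , u∈S) → suc u , there u∈S) (elements S)
elements (outside ∷ S) = map (λ (u , u∈S) → suc u , there u∈S) (elements S)

∈-elements : ∀ {n} (S : Subset n) v → v ∈ˡ elements S
∈-elements (inside  ∷ S) (zero  , here)    = Any.here refl
∈-elements (inside  ∷ S) (suc u , there p) = Any.there (∈-map⁺ _ (∈-elements S (u , p)))
∈-elements (outside ∷ S) (suc u , there p) = ∈-map⁺ _ (∈-elements S (u , p))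

inducedConnected? : ∀ {n} (G : Graph n) S → Dec (Connected (Induced G S))
inducedConnected? G S = connected?
  (≡-dec Fin._≟_ λ p q → yes ([]=-irrelevant p q))
  (λ u v → adj? G (proj₁ u) (proj₁ v))
  (elements S) (∈-elements S)

subsets : ∀ n → List (Subset n)
subsets zero    = [] ∷ []
subsets (suc n) = map (inside ∷_) (subsets n) ++ map (outside ∷_) (subsets n)

module _ {n : ℕ} (G : Graph n) where

  neighbours : Fin n → Subset n
  neighbours u = tabulate (λ v → does (adj? G u v))

  δ : Subset n → Fin n → ℕ
  δ S u = ∣ S ∩ neighbours u ∣

  -- δ_S(u) − δ_S̄(u) + n, reordered so that the subtraction never truncates.
  weight : Subset n → Fin n → ℕ
  weight S u = (δ S u + n) ∸ δ (∁ S) u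

  weight-exact : ∀ S u → ℤ.+ weight S u ≡ (ℤ.+ δ S u ℤ.- ℤ.+ δ (∁ S) u) ℤ.+ ℤ.+ n
  weight-exact S u = begin
    ℤ.+ ((a + n) ∸ b)              ≡⟨ ℤ.⊖-≥ (ℕ.≤-trans (∣p∣≤n (∁ S ∩ neighbours u)) (ℕ.m≤n+m n a)) ⟨
    (a + n) ℤ.⊖ b                  ≡⟨ ℤ.m-n≡m⊖n (a + n) b ⟨
    (ℤ.+ a ℤ.+ ℤ.+ n) ℤ.- ℤ.+ b    ≡⟨ ℤ.+-assoc (ℤ.+ a) (ℤ.+ n) (ℤ.- ℤ.+ b) ⟩
    ℤ.+ a ℤ.+ (ℤ.+ n ℤ.- ℤ.+ b)    ≡⟨ cong (ℤ._+_ (ℤ.+ a)) (ℤ.+-comm (ℤ.+ n) (ℤ.- ℤ.+ b)) ⟩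
    ℤ.+ a ℤ.+ (ℤ.- ℤ.+ b ℤ.+ ℤ.+ n) ≡⟨ ℤ.+-assoc (ℤ.+ a) (ℤ.- ℤ.+ b) (ℤ.+ n) ⟨
    (ℤ.+ a ℤ.- ℤ.+ b) ℤ.+ ℤ.+ n    ∎
    where
    open ≡-Reasoning
    a b : ℕ
    a = δ S u
    b = δ (∁ S) u

  -- The vertex witnessing S ≠ ∅ only supplies the initial value for min.
  f-y : (S : Subset n) → Nonempty S → ℕ
  f-y S (u₀ , _) = min (weight S u₀) (map (weight S ∘ proj₁) (elements S))

  daTerm : Subset n → Poly
  daTerm S with nonempty? S | inducedConnected? G S
  ... | yes S≠∅ | yes _ = x ^ₚ ∣ S ∣ *ₚ y ^ₚ f-y S S≠∅
  ... | _       | _     = const 0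

  da : Poly
  da = ∑ (subsets n) daTerm

{-# OPTIONS --safe #-}
module Submission where

-- In a connected graph of maximum degree 2, a connected set S with at least two but not all
-- vertices has an edge leaving it; there δ_S = δ_S̄ = 1, while δ_S ≥ δ_S̄ everywhere on S, so
-- f_y(S) = n. Hence da is determined by the degrees and by the numbers of connected sets of each
-- size, which in a path are the intervals.
-- Conversely, the terms of degree 1 in x give the number of vertices and their degrees: n
-- vertices, two of degree 1 and n − 2 of degree 2. The term xⁿyⁿ⁺¹ says that G is connected,
-- and a connected graph of maximum degree 2 with a vertex of degree 1 is a path.

open import Defs
open import Data.Bool using (Bool; true; false; if_then_else_; _∧_)
open import Data.Empty using (⊥-elim)
open import Data.Fin using (Fin; zero; suc; toℕ; fromℕ<)
open import Data.Fin.Permutation using (↔⇒≡)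
import Data.Fin.Properties as Fin
open import Data.Fin.Subset using (Subset; inside; outside; ⊤; _∈_; _∉_; _∩_; _-_; ∁; ∣_∣; ⁅_⁆; Nonempty)
open import Data.Fin.Subset.Properties
open import Data.List using (List; []; _∷_; [_]; _++_; map; concat; filter; length; lookup; upTo; applyUpTo; allFin)
open import Data.List.Extrema.Nat using (argmin; argmax; argmin-all; argmax-all; f[argmin]≤f[xs]; f[xs]≤f[argmax]; min≤v⁺; v≤min⁺)
open import Data.List.Membership.Propositional using () renaming (_∈_ to _∈ˡ_; _∉_ to _∉ˡ_)
open import Data.List.Membership.Propositional.Properties
open import Data.List.Membership.Propositional.Properties.WithK using (unique∧set⇒bag)
open import Data.List.Properties using (map-++; map-∘; map-cong; ++-identityʳ; map-applyUpTo; length-map; length-applyUpTo; length-tabulate; applyUpTo-∷ʳ)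
open import Data.List.Relation.Binary.BagAndSetEquality using (∼bag⇒↭)
open import Data.List.Relation.Binary.Permutation.Propositional using (_↭_)
import Data.List.Relation.Binary.Permutation.Propositional.Properties as Perm
open import Data.List.Relation.Unary.All as All using (All; []; _∷_)
import Data.List.Relation.Unary.All.Properties as All
open import Data.List.Relation.Unary.AllPairs using ([]; _∷_)
import Data.List.Relation.Unary.AllPairs.Properties as AllPairs
open import Data.List.Relation.Unary.Any as Any using (here; there)
import Data.List.Relation.Unary.Any.Properties as Any
open import Data.List.Relation.Unary.Unique.Propositional using (Unique)
import Data.List.Relation.Unary.Unique.Propositional.Properties as Unique
open import Data.Nat using (ℕ; zero; suc; pred; _+_; _*_; _∸_; _≤_; _<_; z≤n; s≤s; s≤s⁻¹; z<s; NonZero; >-nonZero; _≟_; _≤?_; _<?_)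
open import Data.Nat.ListAction using (sum)
open import Data.Nat.ListAction.Properties using (sum-++; sum-↭)
import Data.Nat.Properties as ℕ
open import Data.Product using (∃; ∃₂; _×_; _,_; proj₁; proj₂)
open import Data.Sum using (_⊎_; inj₁; inj₂)
import Data.Sum as Sum
open import Data.Vec as Vec using ([]; _∷_)
open import Data.Vec.Properties using ([]=⇒lookup; lookup⇒[]=; lookup∘tabulate; ∷-injectiveʳ)
import Data.Vec.Properties as Vec
open import Data.Vec.Properties.WithK using ([]=-irrelevant)
import Data.Bool.Properties as Bool
open import Function using (_∘_; id; _⇔_; mk⇔; mk↔ₛ′; Equivalence; Inverse)
open import Relation.Binary using (Rel; DecidableEquality)
open import Relation.Binary.Construct.Closure.ReflexiveTransitive as Star using (Star; ε; _◅_)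
open import Relation.Binary.PropositionalEquality using (_≡_; _≢_; refl; sym; trans; cong; cong₂; subst; subst₂; module ≡-Reasoning)
open import Relation.Nullary using (Dec; does; yes; no; ¬_; _×-dec_; contradiction)
open import Relation.Nullary.Decidable using (dec-true; dec-false; decidable-stable)
open import Level using (0ℓ)

-- The order `m` of `G` is not given to be n, so an exponent of `y` cannot be read as a degree at
-- once. The only member of a singleton has all its neighbours outside, whence f_y = m - deg u.
-- Comparing the terms linear in `x` shows that m - deg u equals n - 1 for two vertices and n - 2
-- for n - 2 others, and for no further vertex. Adding the two counts gives m = n, and only then do
-- the exponents determine the degrees. Likewise a connected set of n vertices is recognised as the
-- whole vertex set only after m = n is known.

private variable
  A : Set
  n : ℕ

-- Lists and finite sums

unique-set⇒↭ : {xs ys : List A} → Unique xs → Unique ys →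
  (∀ {a} → a ∈ˡ xs → a ∈ˡ ys) → (∀ {a} → a ∈ˡ ys → a ∈ˡ xs) → xs ↭ ys
unique-set⇒↭ ux uy to from = ∼bag⇒↭ (unique∧set⇒bag ux uy (mk⇔ to from))

sum-filter : {P : A → Set} (P? : ∀ a → Dec (P a)) (f : A → ℕ) → (∀ a → ¬ P a → f a ≡ 0) →
  ∀ xs → sum (map f xs) ≡ sum (map f (filter P? xs))
sum-filter P? f z []       = refl
sum-filter P? f z (a ∷ xs) with P? a
... | yes _ = cong (f a +_) (sum-filter P? f z xs)
... | no ¬p = trans (cong (_+ sum (map f xs)) (z a ¬p)) (sum-filter P? f z xs)

module _ (_≟ᴬ_ : DecidableEquality A) where
  open import Data.List.Membership.DecPropositional _≟ᴬ_ using () renaming (_∈?_ to _∈ˡ?_)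

  -- Filtering `xs` by membership in `ys` drops only zero summands and leaves a permutation of `ys`.
  -- This is how the sum over all subsets shrinks to the subsets that can contribute.
  sum-restrict : ∀ {xs ys} (f : A → ℕ) → Unique xs → (∀ a → a ∈ˡ xs) → Unique ys →
    (∀ a → a ∉ˡ ys → f a ≡ 0) → sum (map f xs) ≡ sum (map f ys)
  sum-restrict {xs} {ys} f ux full uy z = trans (sum-filter (_∈ˡ? ys) f z xs)
    (sum-↭ (Perm.map⁺ f (unique-set⇒↭ (Unique.filter⁺ (_∈ˡ? ys) ux) uy
      (proj₂ ∘ ∈-filter⁻ (_∈ˡ? ys) {xs = xs}) (∈-filter⁺ (_∈ˡ? ys) (full _)))))

sum-map-+ : ∀ (f g : A → ℕ) xs → sum (map (λ a → f a + g a) xs) ≡ sum (map f xs) + sum (map g xs)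
sum-map-+ f g []       = refl
sum-map-+ f g (a ∷ xs) rewrite sum-map-+ f g xs = interchange (f a) (g a) _ _
  where open import Algebra.Properties.CommutativeSemigroup ℕ.+-commutativeSemigroup using (interchange)

sum-map-1 : ∀ (xs : List A) → sum (map (λ _ → 1) xs) ≡ length xs
sum-map-1 []       = refl
sum-map-1 (_ ∷ xs) = cong suc (sum-map-1 xs)

∈⇒≤sum : ∀ (f : A → ℕ) {xs a} → a ∈ˡ xs → f a ≤ sum (map f xs)
∈⇒≤sum f {_ ∷ xs} (here refl) = ℕ.m≤m+n (f _) (sum (map f xs))
∈⇒≤sum f {b ∷ _}  (there p)   = ℕ.≤-trans (∈⇒≤sum f p) (ℕ.m≤n+m _ (f b))

sum≢0⇒∃ : ∀ (f : A → ℕ) xs → sum (map f xs) ≢ 0 → ∃ λ a → f a ≢ 0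
sum≢0⇒∃ f []       ≢0 = contradiction refl ≢0
sum≢0⇒∃ f (a ∷ xs) ≢0 with f a in eq
... | zero  = sum≢0⇒∃ f xs ≢0
... | suc _ = a , λ eq′ → contradiction (trans (sym eq) eq′) λ ()

sum-applyUpTo-cong : ∀ {f g : ℕ → ℕ} k → (∀ {i} → i < k → f i ≡ g i) → sum (applyUpTo f k) ≡ sum (applyUpTo g k)
sum-applyUpTo-cong zero    f≡g = refl
sum-applyUpTo-cong (suc k) f≡g = cong₂ _+_ (f≡g z<s) (sum-applyUpTo-cong k (f≡g ∘ s≤s))

sum-applyUpTo-const : ∀ c k → sum (applyUpTo (λ _ → c) k) ≡ k * c
sum-applyUpTo-const c zero    = refl
sum-applyUpTo-const c (suc k) = cong (c +_) (sum-applyUpTo-const c k)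

-- Serves two splittings of the path: sizes 1 and n against the sizes between them, and the two end
-- vertices against the inner ones.
sum-applyUpTo-ends : ∀ (f : ℕ → ℕ) k → sum (applyUpTo f (2 + k)) ≡ f 0 + (sum (applyUpTo (f ∘ suc) k) + f (suc k))
sum-applyUpTo-ends f k = cong (f 0 +_) (begin
  sum (applyUpTo (f ∘ suc) (suc k))                ≡⟨ cong sum (applyUpTo-∷ʳ (f ∘ suc) k) ⟨
  sum (applyUpTo (f ∘ suc) k ++ [ f (suc k) ])     ≡⟨ sum-++ (applyUpTo (f ∘ suc) k) _ ⟩
  sum (applyUpTo (f ∘ suc) k) + (f (suc k) + 0)    ≡⟨ cong (sum (applyUpTo (f ∘ suc) k) +_) (ℕ.+-identityʳ _) ⟩
  sum (applyUpTo (f ∘ suc) k) + f (suc k)          ∎)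
  where open ≡-Reasoning

sum-concat-applyUpTo : ∀ (g : A → ℕ) (F : ℕ → ℕ → A) (c : ℕ → ℕ) k →
  sum (map g (concat (applyUpTo (λ i → applyUpTo (F i) (c i)) k))) ≡
  sum (applyUpTo (λ i → sum (applyUpTo (g ∘ F i) (c i))) k)
sum-concat-applyUpTo g F c zero    = refl
sum-concat-applyUpTo g F c (suc k) = begin
  sum (map g (xs ++ rest))             ≡⟨ cong sum (map-++ g xs rest) ⟩
  sum (map g xs ++ map g rest)         ≡⟨ sum-++ (map g xs) _ ⟩
  sum (map g xs) + sum (map g rest)    ≡⟨ cong₂ _+_ (cong sum (map-applyUpTo (F 0) g (c 0)))
                                             (sum-concat-applyUpTo g (F ∘ suc) (c ∘ suc) k) ⟩
  _                                    ∎
  where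
  open ≡-Reasoning
  xs rest : List _
  xs   = applyUpTo (F 0) (c 0)
  rest = concat (applyUpTo (λ i → applyUpTo (F (suc i)) (c (suc i))) k)

lookup-injective : {xs : List A} → Unique xs → ∀ i j → lookup xs i ≡ lookup xs j → i ≡ j
lookup-injective (_  ∷ _) zero    zero    _  = refl
lookup-injective (px ∷ _) zero    (suc j) eq = contradiction eq (All.lookup px (∈-lookup j))
lookup-injective (px ∷ _) (suc i) zero    eq = contradiction (sym eq) (All.lookup px (∈-lookup i))
lookup-injective (_  ∷ u) (suc i) (suc j) eq = cong suc (lookup-injective u i j eq)

-- Polynomials

-- The common normal form: the coefficients of both polynomials are rewritten as sums of such values
-- before they are compared.
term : ℕ × ℕ × ℕ → ℕ → ℕ → ℕ
term (c , a , b) i j = if does (a ≟ i) ∧ does (b ≟ j) then c else 0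

term-0 : ∀ a b i j → term (0 , a , b) i j ≡ 0
term-0 a b i j = Bool.if-eta (does (a ≟ i) ∧ does (b ≟ j))

term-* : ∀ k a b i j → k * term (1 , a , b) i j ≡ term (k , a , b) i j
term-* k a b i j with does (a ≟ i) ∧ does (b ≟ j)
... | true  = ℕ.*-identityʳ k
... | false = ℕ.*-zeroʳ k

term-+ : ∀ c d a b i j → term (c + d , a , b) i j ≡ term (c , a , b) i j + term (d , a , b) i j
term-+ c d a b i j with does (a ≟ i) ∧ does (b ≟ j)
... | true  = refl
... | false = refl

term-≢0 : ∀ {c a b} i j → term (c , a , b) i j ≢ 0 → a ≡ i × b ≡ j
term-≢0 {c} {a} {b} i j ≢0 = decidable-stable (a ≟ i ×-dec b ≟ j) λ ¬eq →
  ≢0 (cong (if_then c else 0) (dec-false (a ≟ i ×-dec b ≟ j) ¬eq))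

term-refl : ∀ c a b → term (c , a , b) a b ≡ c
term-refl c a b = cong (if_then c else 0) (dec-true (a ≟ a ×-dec b ≟ b) (refl , refl))

coeff-++ : ∀ p q i j → coeff (p ++ q) i j ≡ coeff p i j + coeff q i j
coeff-++ p q i j = trans (cong sum (map-++ _ p q)) (sum-++ (map _ p) _)

coeff-∑ : ∀ (as : List A) (f : A → Poly) i j → coeff (∑ as f) i j ≡ sum (map (λ a → coeff (f a) i j) as)
coeff-∑ []       f i j = trans (ℕ.+-identityʳ _) (term-0 0 0 i j)
coeff-∑ (a ∷ as) f i j = trans (coeff-++ (f a) _ i j) (cong (coeff (f a) i j +_) (coeff-∑ as f i j))

coeff-[] : ∀ t i j → coeff [ t ] i j ≡ term t i j
coeff-[] t i j = ℕ.+-identityʳ _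

[]-*ₚ-∑ : ∀ t (as : List A) (f : A → Poly) i j →
  coeff ([ t ] *ₚ ∑ as f) i j ≡ sum (map (λ a → coeff ([ t ] *ₚ f a) i j) as)
-- The empty `∑` is not the empty list but the single term `(0 , 0 , 0)`, whose product with `t`
-- still has coefficient 0.
[]-*ₚ-∑ (c , a , b) [] f i j = trans (ℕ.+-identityʳ _)
  (trans (cong (λ c′ → term (c′ , a + 0 , b + 0) i j) (ℕ.*-zeroʳ c)) (term-0 (a + 0) (b + 0) i j))
[]-*ₚ-∑ t (a ∷ as) f i j = begin
  coeff ([ t ] *ₚ (f a ++ ∑ as f)) i j                          ≡⟨ cong (λ p → coeff p i j) distrib ⟩
  coeff (([ t ] *ₚ f a) ++ ([ t ] *ₚ ∑ as f)) i j               ≡⟨ coeff-++ ([ t ] *ₚ f a) _ i j ⟩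
  coeff ([ t ] *ₚ f a) i j + coeff ([ t ] *ₚ ∑ as f) i j        ≡⟨ cong (coeff ([ t ] *ₚ f a) i j +_) ([]-*ₚ-∑ t as f i j) ⟩
  _                                                             ∎
  where
  open ≡-Reasoning
  distrib : [ t ] *ₚ (f a ++ ∑ as f) ≡ ([ t ] *ₚ f a) ++ ([ t ] *ₚ ∑ as f)
  distrib = trans (++-identityʳ _) (trans (map-++ _ (f a) _)
    (sym (cong₂ _++_ (++-identityʳ (map _ (f a))) (++-identityʳ (map _ (∑ as f))))))

x^ : ∀ k → x ^ₚ k ≡ [ (1 , k , 0) ]
x^ zero = refl
x^ (suc k) rewrite x^ k = refl

y^ : ∀ k → y ^ₚ k ≡ [ (1 , 0 , k) ]
y^ zero = refl
y^ (suc k) rewrite y^ k = refl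

x^*y^ : ∀ a b → x ^ₚ a *ₚ y ^ₚ b ≡ [ (1 , a , b) ]
x^*y^ a b rewrite x^ a | y^ b | ℕ.+-identityʳ a = refl

-- With n = `2 + k` the subtractions `n ∸ 1` and `n ∸ 2` compute. The shift of the summation index
-- by 2 turns the range from 2 to n - 1 into `k` summands.
coeff-path : ∀ k i j →
  coeff (const 2 *ₚ x *ₚ y ^ₚ (suc k)
    +ₚ const k *ₚ x *ₚ y ^ₚ k
    +ₚ y ^ₚ (2 + k) *ₚ ∑ [ 2 ⋯ suc k ] (λ i → const (2 + k ∸ i + 1) *ₚ x ^ₚ i)
    +ₚ x ^ₚ (2 + k) *ₚ y ^ₚ (2 + k + 1)) i j ≡
  term (2 , 1 , suc k) i j + term (k , 1 , k) i j
    + sum (applyUpTo (λ l → term (k ∸ l + 1 , 2 + l , 2 + k) i j) k)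
    + term (1 , 2 + k , 2 + k + 1) i j
coeff-path k i j = begin
  coeff (((a ++ b) ++ c) ++ d) i j                                  ≡⟨ coeff-++ ((a ++ b) ++ c) d i j ⟩
  coeff ((a ++ b) ++ c) i j + coeff d i j                           ≡⟨ cong (_+ coeff d i j) (coeff-++ (a ++ b) c i j) ⟩
  coeff (a ++ b) i j + coeff c i j + coeff d i j                    ≡⟨ cong (λ z → z + coeff c i j + coeff d i j) (coeff-++ a b i j) ⟩
  coeff a i j + coeff b i j + coeff c i j + coeff d i j             ≡⟨ cong₂ _+_ (cong₂ _+_ (cong₂ _+_ coeff-a coeff-b) coeff-c) coeff-d ⟩
  _                                                                 ∎
  where
  open ≡-Reasoning
  a b c d : Poly
  a = const 2 *ₚ x *ₚ y ^ₚ (suc k)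
  b = const k *ₚ x *ₚ y ^ₚ k
  c = y ^ₚ (2 + k) *ₚ ∑ [ 2 ⋯ suc k ] (λ i → const (2 + k ∸ i + 1) *ₚ x ^ₚ i)
  d = x ^ₚ (2 + k) *ₚ y ^ₚ (2 + k + 1)

  coeff-a : coeff a i j ≡ term (2 , 1 , suc k) i j
  coeff-a rewrite y^ k = coeff-[] (2 , 1 , suc k) i j

  coeff-b : coeff b i j ≡ term (k , 1 , k) i j
  -- The coefficient arises as `k * 1 * 1`, hence the same rewrite twice.
  coeff-b rewrite y^ k | ℕ.*-identityʳ k | ℕ.*-identityʳ k = coeff-[] (k , 1 , k) i j

  summand : ∀ l → coeff ([ (1 , 0 , 2 + k) ] *ₚ (const (k ∸ l + 1) *ₚ x ^ₚ (2 + l))) i j ≡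
    term (k ∸ l + 1 , 2 + l , 2 + k) i j
  summand l rewrite x^ l | ℕ.*-identityʳ (k ∸ l + 1) | ℕ.+-identityʳ (k ∸ l + 1) | ℕ.+-identityʳ k =
    coeff-[] (k ∸ l + 1 , 2 + l , 2 + k) i j

  coeff-c : coeff c i j ≡ sum (applyUpTo (λ l → term (k ∸ l + 1 , 2 + l , 2 + k) i j) k)
  coeff-c = begin
    coeff c i j
      ≡⟨ cong (λ p → coeff (p *ₚ ∑ [ 2 ⋯ suc k ] (λ i → const (2 + k ∸ i + 1) *ₚ x ^ₚ i)) i j) (y^ (2 + k)) ⟩
    _
      ≡⟨ []-*ₚ-∑ (1 , 0 , 2 + k) [ 2 ⋯ suc k ] (λ i → const (2 + k ∸ i + 1) *ₚ x ^ₚ i) i j ⟩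
    sum (map (λ l → coeff ([ (1 , 0 , 2 + k) ] *ₚ (const (2 + k ∸ l + 1) *ₚ x ^ₚ l)) i j) (map (2 +_) (upTo k)))
      ≡⟨ cong sum (map-∘ (upTo k)) ⟨
    sum (map (λ l → coeff ([ (1 , 0 , 2 + k) ] *ₚ (const (k ∸ l + 1) *ₚ x ^ₚ (2 + l))) i j) (upTo k))
      ≡⟨ cong sum (map-cong summand (upTo k)) ⟩
    sum (map (λ l → term (k ∸ l + 1 , 2 + l , 2 + k) i j) (upTo k))
      ≡⟨ cong sum (map-applyUpTo id _ k) ⟩
    _ ∎

  coeff-d : coeff d i j ≡ term (1 , 2 + k , 2 + k + 1) i j
  coeff-d = trans (cong (λ p → coeff p i j) (x^*y^ (2 + k) (2 + k + 1))) (coeff-[] (1 , 2 + k , 2 + k + 1) i j)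

-- Subsets

∈-subsets : (S : Subset n) → S ∈ˡ subsets n
∈-subsets []            = here refl
∈-subsets (inside  ∷ S) = ∈-++⁺ˡ (∈-map⁺ (inside ∷_) (∈-subsets S))
∈-subsets (outside ∷ S) = ∈-++⁺ʳ (map (inside ∷_) (subsets _)) (∈-map⁺ (outside ∷_) (∈-subsets S))

subsets-unique : ∀ n → Unique (subsets n)
subsets-unique zero    = [] ∷ []
subsets-unique (suc n) = Unique.++⁺
  (Unique.map⁺ ∷-injectiveʳ (subsets-unique n))
  (Unique.map⁺ ∷-injectiveʳ (subsets-unique n))
  λ (p , q) → disjoint (∈-map⁻ (inside ∷_) p) (∈-map⁻ (outside ∷_) q)
  where
  disjoint : ∀ {S : Subset (suc n)} → (∃ λ T → T ∈ˡ subsets n × S ≡ inside ∷ T) →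
    ¬ (∃ λ T → T ∈ˡ subsets n × S ≡ outside ∷ T)
  disjoint (_ , _ , refl) (_ , _ , ())

length-elements : (S : Subset n) → length (elements S) ≡ ∣ S ∣
length-elements []            = refl
length-elements (inside  ∷ S) = cong suc (trans (length-map _ (elements S)) (length-elements S))
length-elements (outside ∷ S) = trans (length-map _ (elements S)) (length-elements S)

private
  proj₁-injective : {S : Subset n} {s t : ∃ (_∈ S)} → proj₁ s ≡ proj₁ t → s ≡ t
  proj₁-injective {s = u , p} {t = .u , q} refl = cong (u ,_) ([]=-irrelevant p q)

  suc-injective : {b : Bool} {S : Subset n} {s t : ∃ (_∈ S)} →
    _≡_ {A = ∃ (_∈ (b ∷ S))} (suc (proj₁ s) , Vec.there (proj₂ s)) (suc (proj₁ t) , Vec.there (proj₂ t)) → s ≡ t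
  suc-injective eq = proj₁-injective (Fin.suc-injective (cong proj₁ eq))

elements-unique : (S : Subset n) → Unique (elements S)
elements-unique []            = []
elements-unique (inside  ∷ S) = All.map⁺ (All.universal (λ _ ()) (elements S)) ∷ Unique.map⁺ suc-injective (elements-unique S)
elements-unique (outside ∷ S) = Unique.map⁺ suc-injective (elements-unique S)

∣∣≡length : (S : Subset n) {xs : List (Fin n)} → Unique xs →
  (∀ {u} → u ∈ˡ xs → u ∈ S) → (∀ {u} → u ∈ S → u ∈ˡ xs) → ∣ S ∣ ≡ length xs
∣∣≡length S {xs} uxs to from = begin
  ∣ S ∣                               ≡⟨ length-elements S ⟨
  length (elements S)                 ≡⟨ length-map proj₁ (elements S) ⟨
  length (map proj₁ (elements S))     ≡⟨ Perm.↭-length (unique-set⇒↭ (Unique.map⁺ proj₁-injective (elements-unique S)) uxs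
                                           (from ∘ ∈S) λ u∈xs → ∈-map⁺ proj₁ (∈-elements S (_ , to u∈xs))) ⟩
  length xs                           ∎
  where
  open ≡-Reasoning
  ∈S : ∀ {u} → u ∈ˡ map proj₁ (elements S) → u ∈ S
  ∈S p with (_ , u∈S) , _ , refl ← ∈-map⁻ proj₁ p = u∈S

-- Each entry is deleted from `S` in turn, which lowers the size. Every lower bound on a degree or
-- on `δ` comes from here, by listing distinct neighbours.
length≤∣∣ : (S : Subset n) {xs : List (Fin n)} → Unique xs → (∀ {u} → u ∈ˡ xs → u ∈ S) → length xs ≤ ∣ S ∣
length≤∣∣ S {[]}     _           _ = z≤n
length≤∣∣ S {u ∷ xs} (u∉ ∷ uxs) ⊆S = ℕ.≤-trans
  (s≤s (length≤∣∣ (S - u) uxs λ v∈xs → x∈p∧x≢y⇒x∈p-y (⊆S (there v∈xs)) (All.lookup u∉ v∈xs ∘ sym)))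
  (x∈p⇒∣p-x∣<∣p∣ (⊆S (here refl)))

∈-tabulate-does : {P : Fin n → Set} (P? : ∀ u → Dec (P u)) → ∀ u → u ∈ Vec.tabulate (does ∘ P?) ⇔ P u
∈-tabulate-does P? u = mk⇔
  (λ p → to (P? u) (trans (sym (lookup∘tabulate _ u)) ([]=⇒lookup p)))
  (λ p → lookup⇒[]= u _ (trans (lookup∘tabulate _ u) (dec-true (P? u) p)))
  where
  to : ∀ {Q : Set} (Q? : Dec Q) → does Q? ≡ true → Q
  to (yes q) _ = q

-- Graphs

-- The first step of the walk out of `P` will do. It supplies both the vertex of weight n in a
-- proper connected set and the edge that prolongs a trail.
crossing : {R : Rel A 0ℓ} {P : A → Set} (P? : ∀ a → Dec (P a)) → ∀ {u v} → Star R u v → P u → ¬ P v →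
  ∃₂ λ a b → R a b × P a × ¬ P b
crossing P? ε        Pu ¬Pv = contradiction Pu ¬Pv
crossing P? (_◅_ {j = w} r rs) Pu ¬Pv with P? w
... | yes Pw = crossing P? rs Pw ¬Pv
... | no ¬Pw = _ , w , r , Pu , ¬Pw

module _ (G : Graph n) where

  deg : Fin n → ℕ
  deg u = ∣ neighbours G u ∣

  ∈-neighbours : ∀ {u v} → v ∈ neighbours G u ⇔ Adj G u v
  ∈-neighbours {u} {v} = ∈-tabulate-does (adj? G u) v

  deg≡length : ∀ {u xs} → Unique xs → (∀ {v} → v ∈ˡ xs → Adj G u v) → (∀ {v} → Adj G u v → v ∈ˡ xs) → deg u ≡ length xs
  deg≡length uxs to from = ∣∣≡length _ uxs (Equivalence.from ∈-neighbours ∘ to) (from ∘ Equivalence.to ∈-neighbours)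

  δ+δ∁ : ∀ S u → δ G S u + δ G (∁ S) u ≡ deg u
  δ+δ∁ S u = split S (neighbours G u)
    where
    split : ∀ {k} (S T : Subset k) → ∣ S ∩ T ∣ + ∣ ∁ S ∩ T ∣ ≡ ∣ T ∣
    split []            []            = refl
    split (inside  ∷ S) (inside  ∷ T) = cong suc (split S T)
    split (inside  ∷ S) (outside ∷ T) = split S T
    split (outside ∷ S) (inside  ∷ T) = trans (ℕ.+-suc _ _) (cong suc (split S T))
    split (outside ∷ S) (outside ∷ T) = split S T

  δ≥1 : ∀ {S u v} → v ∈ S → Adj G u v → 1 ≤ δ G S u
  δ≥1 {S} {u} v∈S uv = length≤∣∣ _ ([] ∷ []) λ { (here refl) → x∈p∩q⁺ (v∈S , Equivalence.from ∈-neighbours uv) }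

  δ-isolated : ∀ {S u} → (∀ {v} → v ∈ S → ¬ Adj G u v) → δ G S u ≡ 0
  δ-isolated {S} {u} ¬uv = trans
    (cong ∣_∣ (Empty-unique λ (v , p) → let q , r = x∈p∩q⁻ S _ p in ¬uv q (Equivalence.to ∈-neighbours r)))
    (∣⊥∣≡0 n)

  -- Irreflexivity leaves no neighbour of `u` in `S`, so all of them are subtracted. Phrasing the
  -- hypothesis by membership lets it apply to `interval a 1` as well as to `⁅ u ⁆`.
  weight-singleton : ∀ {S u} → (∀ {v} → v ∈ S → v ≡ u) → weight G S u ≡ n ∸ deg u
  weight-singleton {S} {u} only = cong₂ (λ a b → a + n ∸ b) δ≡0
    (trans (cong (_+ δ G (∁ S) u) (sym δ≡0)) (δ+δ∁ S u))
    where
    δ≡0 : δ G S u ≡ 0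
    δ≡0 = δ-isolated λ v∈S uv → irrefl G (sym (only v∈S)) uv

  -- The initial value given to `min` is the weight of a member of `S`, so the lower bound `k`
  -- covers it too.
  f-y≡ : ∀ {S k u} ne → (∀ {v} → v ∈ S → k ≤ weight G S v) → u ∈ S → weight G S u ≤ k → f-y G S ne ≡ k
  f-y≡ {S} (_ , u₀∈S) k≤ u∈S ≤k = ℕ.≤-antisym
    (min≤v⁺ _ _ (inj₂ (Any.map (λ { refl → ≤k }) (∈-map⁺ _ (∈-elements S (_ , u∈S))))))
    (v≤min⁺ (k≤ u₀∈S) (All.map⁺ (All.universal (k≤ ∘ proj₂) (elements S))))

  -- `f-y` takes a witness of nonemptiness, and the one inside `daTerm` is chosen by `nonempty?`.
  -- The value is therefore required for every witness.
  daTerm≡ : ∀ {S k w} → Nonempty S → Connected (Induced G S) → ∣ S ∣ ≡ k → (∀ ne → f-y G S ne ≡ w) →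
    ∀ i j → coeff (daTerm G S) i j ≡ term (1 , k , w) i j
  daTerm≡ {S} {w = w} ne conn refl f≡ i j with nonempty? S | inducedConnected? G S
  ... | yes ne′ | yes _ rewrite x^*y^ ∣ S ∣ (f-y G S ne′) | f≡ ne′ = coeff-[] (1 , ∣ S ∣ , w) i j
  ... | yes _   | no ¬c = contradiction conn ¬c
  ... | no ¬ne  | _     = contradiction ne ¬ne

  daTerm≢0 : ∀ S i j → coeff (daTerm G S) i j ≢ 0 → Nonempty S × Connected (Induced G S) × ∣ S ∣ ≡ i
  daTerm≢0 S i j ≢0 with nonempty? S | inducedConnected? G S
  ... | yes ne | yes c rewrite x^*y^ ∣ S ∣ (f-y G S ne) = ne , c ,
    proj₁ (term-≢0 {b = f-y G S ne} i j (≢0 ∘ trans (coeff-[] (1 , ∣ S ∣ , f-y G S ne) i j)))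
  ... | yes _  | no _  = contradiction (trans (ℕ.+-identityʳ _) (term-0 0 0 i j)) ≢0
  ... | no _   | _     = contradiction (trans (ℕ.+-identityʳ _) (term-0 0 0 i j)) ≢0

  -- By `daTerm≢0` a set outside `xs` contributes nothing. The list may contain more than the sets
  -- of size `i`, so the list of all intervals serves for every `i` at once.
  coeff-da : ∀ {xs} i j → Unique xs →
    (∀ {S} → Nonempty S → Connected (Induced G S) → ∣ S ∣ ≡ i → S ∈ˡ xs) →
    coeff (da G) i j ≡ sum (map (λ S → coeff (daTerm G S) i j) xs)
  coeff-da {xs} i j uxs complete = trans (coeff-∑ (subsets n) (daTerm G) i j)
    (sum-restrict _≟ˢ_ _ (subsets-unique n) ∈-subsets uxs λ S S∉ → decidable-stable (_ ≟ 0) λ ≢0 →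
      let ne , c , eq = daTerm≢0 S i j ≢0 in S∉ (complete ne c eq))
    where
    _≟ˢ_ : DecidableEquality (Subset n)
    _≟ˢ_ = Vec.≡-dec Bool._≟_

-- The polynomial of a path

module PathGraph (k : ℕ) (G : Graph (2 + k)) (iso : G ≅ path (2 + k)) where
  open _≅_ iso
  open Inverse bijection using (to; from; strictlyInverseˡ; strictlyInverseʳ)

  pos : Fin (2 + k) → ℕ
  pos = toℕ ∘ to

  pos<n : ∀ u → pos u < 2 + k
  pos<n u = Fin.toℕ<n (to u)

  -- The value for l ≥ 2 + k is junk.
  at : ℕ → Fin (2 + k)
  at l with l <? 2 + k
  ... | yes l<n = from (fromℕ< l<n)
  ... | no _    = zero

  pos-at : ∀ {l} → l < 2 + k → pos (at l) ≡ l
  pos-at {l} l<n with l <? 2 + k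
  ... | yes p = trans (cong toℕ (strictlyInverseˡ (fromℕ< p))) (Fin.toℕ-fromℕ< p)
  ... | no ¬p = contradiction l<n ¬p

  pos-injective : ∀ {u v} → pos u ≡ pos v → u ≡ v
  pos-injective {u} {v} eq = trans (sym (strictlyInverseʳ u))
    (trans (cong from (Fin.toℕ-injective eq)) (strictlyInverseʳ v))

  at-pos : ∀ u → at (pos u) ≡ u
  at-pos u = pos-injective (pos-at (pos<n u))

  at-injective : ∀ {l l′} → l < 2 + k → l′ < 2 + k → at l ≡ at l′ → l ≡ l′
  at-injective p q eq = trans (sym (pos-at p)) (trans (cong pos eq) (pos-at q))

  Adj⇒ : ∀ {u v} → Adj G u v → suc (pos u) ≡ pos v ⊎ suc (pos v) ≡ pos u
  Adj⇒ = Equivalence.to (preserves _ _)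

  Adj⇐ : ∀ {u v} → suc (pos u) ≡ pos v ⊎ suc (pos v) ≡ pos u → Adj G u v
  Adj⇐ = Equivalence.from (preserves _ _)

  Adj-at : ∀ {l} → suc l < 2 + k → Adj G (at l) (at (suc l))
  Adj-at 1+l<n = Adj⇐ (inj₁ (trans (cong suc (pos-at (ℕ.<-trans (ℕ.n<1+n _) 1+l<n))) (sym (pos-at 1+l<n))))

  deg-first : deg G (at 0) ≡ 1
  deg-first = deg≡length G ([] ∷ []) (λ { (here refl) → Adj-at (s≤s z<s) })
    λ {v} a → here (trans (sym (at-pos v)) (cong at (next (Adj⇒ a))))
    where
    next : ∀ {v} → suc (pos (at 0)) ≡ pos v ⊎ suc (pos v) ≡ pos (at 0) → pos v ≡ 1
    next (inj₁ e) = trans (sym e) (cong suc (pos-at z<s))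
    next (inj₂ e) = contradiction (trans e (pos-at z<s)) λ ()

  deg-last : deg G (at (suc k)) ≡ 1
  deg-last = deg≡length G ([] ∷ []) (λ { (here refl) → symm G (Adj-at ℕ.≤-refl) })
    λ {v} a → here (trans (sym (at-pos v)) (cong at (prev (Adj⇒ a))))
    where
    prev : ∀ {v} → suc (pos (at (suc k))) ≡ pos v ⊎ suc (pos v) ≡ pos (at (suc k)) → pos v ≡ k
    prev {v} (inj₁ e) = contradiction (trans (cong suc (sym (pos-at ℕ.≤-refl))) e) (ℕ.<⇒≢ (pos<n v) ∘ sym)
    prev (inj₂ e) = ℕ.suc-injective (trans e (pos-at ℕ.≤-refl))

  deg-middle : ∀ {l} → l < k → deg G (at (suc l)) ≡ 2
  deg-middle {l} l<k = deg≡length G ((l≢ ∷ []) ∷ [] ∷ [])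
    (λ { (here refl) → symm G (Adj-at 1+l<n) ; (there (here refl)) → Adj-at (s≤s (s≤s l<k)) })
    λ {v} a → neighbour v (Adj⇒ a)
    where
    1+l<n : suc l < 2 + k
    1+l<n = ℕ.m≤n⇒m≤1+n (s≤s l<k)
    l≢ : at l ≢ at (2 + l)
    l≢ eq = ℕ.m≢1+n+m l {1} (at-injective (ℕ.<-trans ℕ.≤-refl 1+l<n) (s≤s (s≤s l<k)) eq)
    neighbour : ∀ v → suc (pos (at (suc l))) ≡ pos v ⊎ suc (pos v) ≡ pos (at (suc l)) → v ∈ˡ at l ∷ at (2 + l) ∷ []
    neighbour v (inj₁ e) = there (here (trans (sym (at-pos v)) (cong at (trans (sym e) (cong suc (pos-at 1+l<n))))))
    neighbour v (inj₂ e) = here (trans (sym (at-pos v)) (cong at (ℕ.suc-injective (trans e (pos-at 1+l<n)))))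

  deg-bounds : ∀ u → 1 ≤ deg G u × deg G u ≤ 2
  deg-bounds u = subst (λ v → 1 ≤ deg G v × deg G v ≤ 2) (at-pos u) (bounds (pos u) (pos<n u))
    where
    bounds : ∀ l → l < 2 + k → 1 ≤ deg G (at l) × deg G (at l) ≤ 2
    bounds zero    _ rewrite deg-first = s≤s z≤n , s≤s z≤n
    bounds (suc l) (s≤s l<1+k) with ℕ.m<1+n⇒m<n∨m≡n l<1+k
    ... | inj₁ l<k  rewrite deg-middle l<k = s≤s z≤n , s≤s (s≤s z≤n)
    ... | inj₂ refl rewrite deg-last = s≤s z≤n , s≤s z≤n

  interval? : ∀ a s u → Dec (a ≤ pos u × pos u < a + s)
  interval? a s u = (a ≤? pos u) ×-dec (pos u <? a + s)

  -- Opaque, so that the endpoint and the size can be inferred from an interval.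
  opaque
    interval : ℕ → ℕ → Subset (2 + k)
    interval a s = Vec.tabulate (does ∘ interval? a s)

    ∈-interval : ∀ {a s u} → u ∈ interval a s ⇔ (a ≤ pos u × pos u < a + s)
    ∈-interval {a} {s} {u} = ∈-tabulate-does (interval? a s) u

  at∈interval : ∀ {a s l} → l < 2 + k → a ≤ l → l < a + s → at l ∈ interval a s
  at∈interval {a} {s} l<n a≤l l<a+s = Equivalence.from ∈-interval
    (subst (λ m → a ≤ m × m < a + s) (sym (pos-at l<n)) (a≤l , l<a+s))

  ∣interval∣ : ∀ {a s} → a + s ≤ 2 + k → ∣ interval a s ∣ ≡ s
  ∣interval∣ {a} {s} a+s≤n = trans
    (∣∣≡length _ (Unique.applyUpTo⁺₁ (at ∘ (a +_)) s distinct) ∈⇒ ⇒∈)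
    (length-applyUpTo _ s)
    where
    <n : ∀ {i} → i < s → a + i < 2 + k
    <n i<s = ℕ.<-≤-trans (ℕ.+-monoʳ-< a i<s) a+s≤n
    distinct : ∀ {i j} → i < j → j < s → at (a + i) ≢ at (a + j)
    distinct i<j j<s eq = ℕ.<⇒≢ i<j (ℕ.+-cancelˡ-≡ a _ _ (at-injective (<n (ℕ.<-trans i<j j<s)) (<n j<s) eq))
    ∈⇒ : ∀ {u} → u ∈ˡ applyUpTo (at ∘ (a +_)) s → u ∈ interval a s
    ∈⇒ p with i , i<s , refl ← ∈-applyUpTo⁻ (at ∘ (a +_)) p = at∈interval (<n i<s) (ℕ.m≤m+n a i) (ℕ.+-monoʳ-< a i<s)
    ⇒∈ : ∀ {u} → u ∈ interval a s → u ∈ˡ applyUpTo (at ∘ (a +_)) s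
    ⇒∈ {u} p = let a≤ , <a+s = Equivalence.to ∈-interval p; eq = ℕ.m+[n∸m]≡n a≤ in
      subst (_∈ˡ applyUpTo (at ∘ (a +_)) s) (trans (cong at eq) (at-pos u))
        (∈-applyUpTo⁺ (at ∘ (a +_)) (ℕ.+-cancelˡ-< a _ _ (subst (_< a + s) (sym eq) <a+s)))

  walk : ∀ {a s} d {u v} (p : u ∈ interval a s) (q : v ∈ interval a s) → d + pos u ≡ pos v →
    Star (Induced G (interval a s)) (u , p) (v , q)
  -- Vertices of the induced graph carry their membership proofs, which have to be identified as
  -- well.
  walk zero p q eq with refl ← pos-injective eq with refl ← []=-irrelevant p q = ε
  walk {a} {s} (suc d) {u} {v} p q eq = Adj⇐ (inj₁ (sym pos-w)) ◅ walk d w∈ q (trans (cong (d +_) pos-w) 1+u+d≡v)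
    where
    1+u+d≡v : d + suc (pos u) ≡ pos v
    1+u+d≡v = trans (ℕ.+-suc d (pos u)) eq
    1+u≤v : suc (pos u) ≤ pos v
    1+u≤v = subst (suc (pos u) ≤_) 1+u+d≡v (ℕ.m≤n+m _ d)
    1+u<n : suc (pos u) < 2 + k
    1+u<n = ℕ.≤-<-trans 1+u≤v (pos<n v)
    pos-w : pos (at (suc (pos u))) ≡ suc (pos u)
    pos-w = pos-at 1+u<n
    w∈ : at (suc (pos u)) ∈ interval a s
    w∈ = at∈interval 1+u<n (ℕ.m≤n⇒m≤1+n (proj₁ (Equivalence.to ∈-interval p)))
      (ℕ.≤-<-trans 1+u≤v (proj₂ (Equivalence.to ∈-interval q)))

  interval-connected : ∀ a s → Connected (Induced G (interval a s))
  interval-connected a s (u , p) (v , q) with ℕ.≤-total (pos u) (pos v)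
  ... | inj₁ u≤v = walk (pos v ∸ pos u) p q (ℕ.m∸n+n≡m u≤v)
  ... | inj₂ v≤u = Star.reverse (symm G) (walk (pos u ∸ pos v) q p (ℕ.m∸n+n≡m v≤u))

  connected : ∀ u v → Star (Adj G) u v
  connected u v = Star.gmap proj₁ id (interval-connected 0 (2 + k) (u , all u) (v , all v))
    where
    all : ∀ w → w ∈ interval 0 (2 + k)
    all w = Equivalence.from ∈-interval (z≤n , pos<n w)

  -- A discrete intermediate value theorem: an edge changes the position by exactly one, so a walk
  -- cannot jump over `l`.
  between : ∀ {S s t l} → Star (Induced G S) s t → pos (proj₁ s) ≤ l → l ≤ pos (proj₁ t) → at l ∈ S
  between {S} {s} ε s≤l l≤s = subst (_∈ S) (trans (sym (at-pos (proj₁ s))) (cong at (ℕ.≤-antisym s≤l l≤s))) (proj₂ s)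
  between {S} {s} {t} {l} (r ◅ rs) s≤l l≤t with ℕ.m≤n⇒m<n∨m≡n s≤l
  ... | inj₂ refl = subst (_∈ S) (sym (at-pos (proj₁ s))) (proj₂ s)
  ... | inj₁ s<l  = between rs (step (Adj⇒ r)) l≤t
    where
    step : ∀ {w} → suc (pos (proj₁ s)) ≡ w ⊎ suc w ≡ pos (proj₁ s) → w ≤ l
    step (inj₁ refl) = s<l
    step (inj₂ e)    = ℕ.≤-trans (ℕ.n≤1+n _) (ℕ.≤-trans (ℕ.≤-reflexive e) s≤l)

  -- The ends are the members of least and greatest position; a walk joining them inside `S` meets
  -- every position between, by `between`. The size has the form `suc s` because `S` is nonempty.
  connected⇒interval : ∀ {S} → Nonempty S → Connected (Induced G S) →
    ∃₂ λ a s → a + suc s ≤ 2 + k × S ≡ interval a (suc s)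
  connected⇒interval {S} (u₀ , u₀∈S) conn = pos lo , pos hi ∸ pos lo , bound , ⊆-antisym ⊆I I⊆
    where
    us = map proj₁ (elements S)
    lo = argmin pos u₀ us
    hi = argmax pos u₀ us
    us⊆S : All (_∈ S) us
    us⊆S = All.map⁺ (All.universal proj₂ (elements S))
    lo∈S = argmin-all pos u₀∈S us⊆S
    hi∈S = argmax-all pos u₀∈S us⊆S
    lo≤ : ∀ {u} → u ∈ S → pos lo ≤ pos u
    lo≤ p = All.lookup (f[argmin]≤f[xs] u₀ us) (∈-map⁺ proj₁ (∈-elements S (_ , p)))
    ≤hi : ∀ {u} → u ∈ S → pos u ≤ pos hi
    ≤hi p = All.lookup (f[xs]≤f[argmax] u₀ us) (∈-map⁺ proj₁ (∈-elements S (_ , p)))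
    end : pos lo + suc (pos hi ∸ pos lo) ≡ suc (pos hi)
    end = trans (ℕ.+-suc (pos lo) _) (cong suc (ℕ.m+[n∸m]≡n (lo≤ hi∈S)))
    bound : pos lo + suc (pos hi ∸ pos lo) ≤ 2 + k
    bound = ℕ.≤-trans (ℕ.≤-reflexive end) (pos<n hi)
    ⊆I : ∀ {u} → u ∈ S → u ∈ interval (pos lo) (suc (pos hi ∸ pos lo))
    ⊆I {u} p = Equivalence.from ∈-interval (lo≤ p , subst (pos u <_) (sym end) (s≤s (≤hi p)))
    I⊆ : ∀ {u} → u ∈ interval (pos lo) (suc (pos hi ∸ pos lo)) → u ∈ S
    I⊆ {u} p with lo≤u , u<end ← Equivalence.to ∈-interval p = subst (_∈ S) (at-pos u)
      (between (conn (lo , lo∈S) (hi , hi∈S)) lo≤u (s≤s⁻¹ (subst (pos u <_) end u<end)))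

  -- An interval of size i = `suc s` has n - i + 1 = `2 + k ∸ s` possible left ends. This is the
  -- origin of the coefficient n - i + 1 in the formula.
  intervalsOfSize1+ : ℕ → List (Subset (2 + k))
  intervalsOfSize1+ s = applyUpTo (λ a → interval a (suc s)) (2 + k ∸ s)

  intervals : List (Subset (2 + k))
  intervals = concat (applyUpTo intervalsOfSize1+ (2 + k))

  fits : ∀ {a s} → s < 2 + k → a < 2 + k ∸ s → a + suc s ≤ 2 + k
  fits {a} {s} s<n a<n∸s = subst (_≤ 2 + k) (sym (ℕ.+-suc a s)) (ℕ.m≤o∸n⇒m+n≤o (suc a) (ℕ.<⇒≤ s<n) a<n∸s)

  connected⇒∈intervals : ∀ {S} → Nonempty S → Connected (Induced G S) → S ∈ˡ intervals
  connected⇒∈intervals ne conn with a , s , bound , refl ← connected⇒interval ne conn =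
    ∈-concat⁺′ (∈-applyUpTo⁺ (λ a → interval a (suc s)) (ℕ.m+n≤o⇒m≤o∸n (suc a) bound′))
      (∈-applyUpTo⁺ intervalsOfSize1+ (ℕ.≤-trans (ℕ.m≤n+m (suc s) a) bound))
    where
    bound′ : suc a + s ≤ 2 + k
    bound′ = subst (_≤ 2 + k) (ℕ.+-suc a s) bound

  -- Two intervals of equal size are told apart by the smaller of their left ends, intervals of
  -- different sizes by cardinality.
  intervals-unique : Unique intervals
  intervals-unique = Unique.concat⁺
    (All.applyUpTo⁺₁ intervalsOfSize1+ (2 + k) λ {s} s<n → Unique.applyUpTo⁺₁ _ (2 + k ∸ s) λ {a} a<b b<n∸s eq →
      ℕ.<⇒≱ a<b (subst (_ ≤_) (pos-at (a<n s<n (ℕ.<-trans a<b b<n∸s)))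
        (proj₁ (Equivalence.to ∈-interval (subst (at a ∈_) eq
          (at∈interval (a<n s<n (ℕ.<-trans a<b b<n∸s)) ℕ.≤-refl (ℕ.m<m+n a z<s)))))))
    (AllPairs.applyUpTo⁺₁ intervalsOfSize1+ (2 + k) λ s<t t<n (p , q) →
      ℕ.<⇒≢ s<t (ℕ.suc-injective (trans (sym (size (ℕ.<-trans s<t t<n) p)) (size t<n q))))
    where
    a<n : ∀ {a s} → s < 2 + k → a < 2 + k ∸ s → a < 2 + k
    a<n {s = s} _ a<n∸s = ℕ.<-≤-trans a<n∸s (ℕ.m∸n≤m _ s)
    size : ∀ {S s} → s < 2 + k → S ∈ˡ intervalsOfSize1+ s → ∣ S ∣ ≡ suc s
    size s<n p with a , a< , refl ← ∈-applyUpTo⁻ (λ a → interval a _) p = ∣interval∣ {a} (fits s<n a<)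

  -- The degree is at most 2, so one neighbour in `S` leaves at most one outside.
  weight≥n : ∀ S u → 1 ≤ δ G S u → 2 + k ≤ weight G S u
  weight≥n S u 1≤δ = ℕ.m+n≤o⇒m≤o∸n (2 + k)
    (subst (2 + k + δ G (∁ S) u ≤_) (ℕ.+-comm (2 + k) (δ G S u))
      (ℕ.+-monoʳ-≤ (2 + k) (balance 1≤δ (subst (_≤ 2) (sym (δ+δ∁ G S u)) (proj₂ (deg-bounds u))))))
    where
    balance : ∀ {a b} → 1 ≤ a → a + b ≤ 2 → b ≤ a
    balance (s≤s {n = a} z≤n) (s≤s a+b≤1) = ℕ.≤-trans (ℕ.≤-trans (ℕ.m≤n+m _ a) a+b≤1) (s≤s z≤n)

  -- A neighbour on each side exhausts the degree, so both counts are 1 and cancel.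
  weight≤n : ∀ S u → 1 ≤ δ G S u → 1 ≤ δ G (∁ S) u → weight G S u ≤ 2 + k
  weight≤n S u 1≤δ 1≤δ∁ = ℕ.m≤n+o⇒m∸n≤o _ (δ G (∁ S) u)
    (ℕ.+-monoˡ-≤ (2 + k) (balance 1≤δ 1≤δ∁ (subst (_≤ 2) (sym (δ+δ∁ G S u)) (proj₂ (deg-bounds u)))))
    where
    balance : ∀ {a b} → 1 ≤ a → 1 ≤ b → a + b ≤ 2 → a ≤ b
    balance {a} {b} _ 1≤b a+b≤2 =
      ℕ.≤-trans (s≤s⁻¹ (ℕ.≤-trans (ℕ.≤-reflexive (ℕ.+-comm 1 a)) (ℕ.≤-trans (ℕ.+-monoʳ-≤ a 1≤b) a+b≤2))) 1≤b

  -- The left end has its right neighbour in the interval, because the size is at least 2; every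
  -- other member has its left neighbour there.
  interval-inner : ∀ {a s u} → a + (2 + s) ≤ 2 + k → u ∈ interval a (2 + s) → 1 ≤ δ G (interval a (2 + s)) u
  interval-inner {a} {s} {u} bound u∈ with ℕ.m≤n⇒m<n∨m≡n (proj₁ (Equivalence.to ∈-interval u∈))
  ... | inj₂ a≡u = δ≥1 G (at∈interval {l = suc a} 1+a<n (ℕ.n≤1+n a) 1+a<end)
      (Adj⇐ (inj₁ (trans (cong suc (sym a≡u)) (sym (pos-at 1+a<n)))))
    where
    1+a<end : suc a < a + (2 + s)
    1+a<end = subst (suc a <_) (sym (trans (ℕ.+-suc a (suc s)) (cong suc (ℕ.+-suc a s)))) (s≤s (s≤s (ℕ.m≤m+n a s)))
    1+a<n : suc a < 2 + k
    1+a<n = ℕ.<-≤-trans 1+a<end bound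
  ... | inj₁ a<u = δ≥1 G (at∈interval {l = pred (pos u)} l<n
         (s≤s⁻¹ (subst (a <_) (sym suc-pred) a<u)) (ℕ.<-trans (ℕ.≤-reflexive suc-pred) u<end))
      (Adj⇐ (inj₂ (trans (cong suc (pos-at l<n)) suc-pred)))
    where
    u<end : pos u < a + (2 + s)
    u<end = proj₂ (Equivalence.to ∈-interval u∈)
    suc-pred : suc (pred (pos u)) ≡ pos u
    suc-pred = ℕ.suc-pred (pos u) ⦃ >-nonZero (ℕ.≤-<-trans z≤n a<u) ⦄
    l<n : pred (pos u) < 2 + k
    l<n = ℕ.<-trans (ℕ.≤-reflexive suc-pred) (pos<n u)

  f-singleton : ∀ {a} → a < 2 + k → ∀ ne → f-y G (interval a 1) ne ≡ 2 + k ∸ deg G (at a)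
  f-singleton {a} a<n ne = f-y≡ G {u = at a} ne
    (λ {v} v∈ → ℕ.≤-reflexive (sym (trans (cong (weight G (interval a 1)) (only v∈)) w≡)))
    (at∈interval a<n ℕ.≤-refl (ℕ.m<m+n a z<s)) (ℕ.≤-reflexive w≡)
    where
    only : ∀ {v} → v ∈ interval a 1 → v ≡ at a
    only {v} v∈ with a≤v , v<a+1 ← Equivalence.to ∈-interval v∈ =
      trans (sym (at-pos v)) (cong at (ℕ.≤-antisym (s≤s⁻¹ (subst (pos v <_) (ℕ.+-comm a 1) v<a+1)) a≤v))
    w≡ : weight G (interval a 1) (at a) ≡ 2 + k ∸ deg G (at a)
    w≡ = weight-singleton G only

  ∃∉interval : ∀ {a s} → a + s ≤ 2 + k → s < 2 + k → ∃ (_∉ interval a s)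
  ∃∉interval {a} {s} bound s<n = Fin.¬∀⟶∃¬ _ (_∈ interval a s) (_∈? interval a s) λ all → ℕ.<⇒≢ s<n (begin
    s                   ≡⟨ ∣interval∣ bound ⟨
    ∣ interval a s ∣    ≡⟨ cong ∣_∣ (⊆-antisym (⊆-max _) (λ {u} _ → all u)) ⟩
    ∣ ⊤ {2 + k} ∣       ≡⟨ ∣⊤∣≡n (2 + k) ⟩
    2 + k               ∎)
    where open ≡-Reasoning

  f-proper : ∀ {a s} → a + (2 + s) ≤ 2 + k → s < k → ∀ ne → f-y G (interval a (2 + s)) ne ≡ 2 + k
  f-proper {a} {s} bound s<k ne@(u₀ , u₀∈)
    with z , z∉ ← ∃∉interval bound (s≤s (s≤s s<k))
    with u , v , uv , u∈ , v∉ ← crossing (_∈? interval a (2 + s)) (connected u₀ z) u₀∈ z∉ =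
    f-y≡ G ne (λ {w} w∈ → weight≥n (interval a (2 + s)) w (interval-inner bound w∈)) u∈
      (weight≤n (interval a (2 + s)) u (interval-inner bound u∈) (δ≥1 G (x∉p⇒x∈∁p v∉) uv))

  -- No neighbour lies outside, so the weight of v is deg v + n. An end vertex, of degree 1, attains
  -- the minimum, which explains the exponent n + 1.
  f-whole : ∀ ne → f-y G (interval 0 (2 + k)) ne ≡ 2 + k + 1
  f-whole ne = f-y≡ G {u = at 0} ne
    (λ {v} _ → ℕ.≤-trans (ℕ.≤-reflexive (ℕ.+-comm (2 + k) 1))
      (ℕ.≤-trans (ℕ.+-monoˡ-≤ (2 + k) (proj₁ (deg-bounds v))) (ℕ.≤-reflexive (sym (w≡ v)))))
    (at∈interval z<s z≤n z<s)
    (ℕ.≤-reflexive (trans (w≡ (at 0)) (trans (cong (_+ (2 + k)) deg-first) (ℕ.+-comm 1 (2 + k)))))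
    where
    w≡ : ∀ v → weight G (interval 0 (2 + k)) v ≡ deg G v + (2 + k)
    w≡ v = trans (cong (λ S → weight G S v) (⊆-antisym (⊆-max _) λ {u} _ → Equivalence.from ∈-interval (z≤n , pos<n u)))
      (cong₂ (λ a b → a + (2 + k) ∸ b) δ≡ (ℕ.+-cancelˡ-≡ (deg G v) _ 0
        (trans (trans (cong (_+ δ G (∁ ⊤) v) (sym δ≡)) (δ+δ∁ G ⊤ v)) (sym (ℕ.+-identityʳ _)))))
      where
      δ≡ : δ G ⊤ v ≡ deg G v
      δ≡ = cong ∣_∣ (∩-identityˡ (neighbours G v))

  daTerm-interval : ∀ {a s w} → a + suc s ≤ 2 + k → (∀ ne → f-y G (interval a (suc s)) ne ≡ w) →
    ∀ i j → coeff (daTerm G (interval a (suc s))) i j ≡ term (1 , suc s , w) i j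
  daTerm-interval {a} {s} bound = daTerm≡ G
    (at a , at∈interval (ℕ.<-≤-trans (ℕ.m<m+n a z<s) bound) ℕ.≤-refl (ℕ.m<m+n a z<s))
    (interval-connected a (suc s)) (∣interval∣ bound)

  coeff-da-path : ∀ i j → coeff (da G) i j ≡
    term (2 , 1 , suc k) i j + term (k , 1 , k) i j
      + sum (applyUpTo (λ l → term (k ∸ l + 1 , 2 + l , 2 + k) i j) k)
      + term (1 , 2 + k , 2 + k + 1) i j
  coeff-da-path i j = begin
    coeff (da G) i j
      ≡⟨ coeff-da G i j intervals-unique (λ ne conn _ → connected⇒∈intervals ne conn) ⟩
    sum (map (λ S → coeff (daTerm G S) i j) intervals)
      ≡⟨ sum-concat-applyUpTo (λ S → coeff (daTerm G S) i j) (λ s a → interval a (suc s)) (2 + k ∸_) (2 + k) ⟩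
    sum (applyUpTo size (2 + k))
      -- Sizes 1 and n are split off: only the sizes between them have all exponents of `y` equal to
      -- n.
      ≡⟨ sum-applyUpTo-ends size k ⟩
    size 0 + (sum (applyUpTo (size ∘ suc) k) + size (suc k))
      ≡⟨ cong₂ _+_ size-1 (cong₂ _+_ (sum-applyUpTo-cong k size-proper) size-n) ⟩
    (leaf + (middle + leaf)) + (proper + whole)
      ≡⟨ rearrange leaf middle proper whole ⟩
    leaf + leaf + middle + proper + whole
      ≡⟨ cong (λ z → z + middle + proper + whole) (term-+ 1 1 1 (suc k) i j) ⟨
    term (2 , 1 , suc k) i j + middle + proper + whole ∎
    where
    open ≡-Reasoning
    open import Data.Nat.Tactic.RingSolver using (solve-∀)

    rearrange : ∀ a b c d → (a + (b + a)) + (c + d) ≡ a + a + b + c + d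
    rearrange = solve-∀

    size : ℕ → ℕ
    size s = sum (applyUpTo (λ a → coeff (daTerm G (interval a (suc s))) i j) (2 + k ∸ s))

    leaf middle proper whole : ℕ
    leaf   = term (1 , 1 , suc k) i j
    middle = term (k , 1 , k) i j
    proper = sum (applyUpTo (λ l → term (k ∸ l + 1 , 2 + l , 2 + k) i j) k)
    whole  = term (1 , 2 + k , 2 + k + 1) i j

    singleton : ∀ {a d} → a < 2 + k → deg G (at a) ≡ d →
      coeff (daTerm G (interval a 1)) i j ≡ term (1 , 1 , 2 + k ∸ d) i j
    singleton {a} a<n d≡ = daTerm-interval (fits {a} z<s a<n) (λ ne → trans (f-singleton a<n ne) (cong (2 + k ∸_) d≡)) i j

    size-1 : size 0 ≡ leaf + (middle + leaf)
    size-1 = trans (sum-applyUpTo-ends (λ a → coeff (daTerm G (interval a 1)) i j) k)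
      (cong₂ _+_ (singleton z<s deg-first) (cong₂ _+_
        (trans (sum-applyUpTo-cong k λ l<k → singleton (ℕ.m≤n⇒m≤1+n (s≤s l<k)) (deg-middle l<k))
          (trans (sum-applyUpTo-const (term (1 , 1 , k) i j) k) (term-* k 1 k i j)))
        (singleton ℕ.≤-refl deg-last)))

    size-proper : ∀ {l} → l < k → size (suc l) ≡ term (k ∸ l + 1 , 2 + l , 2 + k) i j
    size-proper {l} l<k = begin
      size (suc l)
        ≡⟨ sum-applyUpTo-cong (suc k ∸ l) (λ a< → let bound = fits (s≤s (ℕ.m≤n⇒m≤1+n l<k)) a< in
             daTerm-interval bound (f-proper bound l<k) i j) ⟩
      sum (applyUpTo (λ _ → term (1 , 2 + l , 2 + k) i j) (suc k ∸ l))
        ≡⟨ sum-applyUpTo-const (term (1 , 2 + l , 2 + k) i j) (suc k ∸ l) ⟩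
      (suc k ∸ l) * term (1 , 2 + l , 2 + k) i j
        ≡⟨ term-* (suc k ∸ l) (2 + l) (2 + k) i j ⟩
      term (suc k ∸ l , 2 + l , 2 + k) i j
        -- Subtraction truncates, so `suc k ∸ l` agrees with `k ∸ l + 1` only thanks to `l ≤ k`.
        ≡⟨ cong (λ c → term (c , 2 + l , 2 + k) i j) (trans (cong (_∸ l) (ℕ.+-comm 1 k)) (ℕ.+-∸-comm 1 (ℕ.<⇒≤ l<k))) ⟩
      _ ∎

    size-n : size (suc k) ≡ whole
    size-n = begin
      size (suc k)
        ≡⟨ cong (λ c → sum (applyUpTo (λ a → coeff (daTerm G (interval a (2 + k))) i j) c)) (ℕ.m+n∸n≡m 1 k) ⟩
      coeff (daTerm G (interval 0 (2 + k))) i j + 0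
        ≡⟨ ℕ.+-identityʳ _ ⟩
      coeff (daTerm G (interval 0 (2 + k))) i j
        ≡⟨ daTerm-interval ℕ.≤-refl f-whole i j ⟩
      whole ∎

-- Hamiltonian trails in graphs of maximum degree 2

-- A walk from an end vertex of degree 1 in a connected graph of maximum degree 2 can leave
-- the set of visited vertices only at its tip, so it can be prolonged until it is Hamiltonian.
module TrailFrom {m : ℕ} (G : Graph m) (v₀ : Fin m) (deg-v₀ : deg G v₀ ≡ 1) (deg≤2 : ∀ u → deg G u ≤ 2)
  (connected : ∀ u v → Star (Adj G) u v) where

  open import Data.List.Membership.DecPropositional (Fin._≟_ {m}) using () renaming (_∈?_ to _∈ˡ?_)

  -- The list runs from the tip back to v₀.
  data Trail : Fin m → List (Fin m) → Set where
    start : Trail v₀ []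
    step  : ∀ {u us w} → Trail u us → w ∉ˡ u ∷ us → Adj G u w → Trail w (u ∷ us)

  neighbours-distinct : ∀ {u vs} → Unique vs → (∀ {v} → v ∈ˡ vs → Adj G u v) → length vs ≤ deg G u
  neighbours-distinct uvs adj = length≤∣∣ _ uvs (Equivalence.from (∈-neighbours G) ∘ adj)

  trail-unique : ∀ {u us} → Trail u us → Unique (u ∷ us)
  trail-unique start = [] ∷ []
  trail-unique (step t w∉ _) = All.¬Any⇒All¬ _ w∉ ∷ trail-unique t

  -- All edges at `v` are used up. If `v` is `v₀`, its single neighbour is the next vertex of the
  -- trail; otherwise its predecessor and successor already make up degree 2. A further neighbour
  -- would exceed the degree bound.
  trail-saturated : ∀ {u us v w} → Trail u us → v ∈ˡ us → Adj G v w → w ∈ˡ u ∷ us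
  trail-saturated (step t _ _) (there v∈) vw = there (trail-saturated t v∈ vw)
  trail-saturated {u} {w = w} (step start u∉ v₀u) (here refl) v₀w with w Fin.≟ u
  ... | yes refl = here refl
  ... | no w≢u   = contradiction (subst (2 ≤_) deg-v₀ (neighbours-distinct ((w≢u ∷ []) ∷ [] ∷ [])
          λ { (here refl) → v₀w ; (there (here refl)) → v₀u })) λ { (s≤s ()) }
  trail-saturated {u} {w = w} (step (step {z} t _ zv) u∉ vu) (here refl) vw with w Fin.≟ u | w Fin.≟ z
  ... | yes refl | _        = here refl
  ... | no _     | yes refl = there (there (here refl))
  ... | no w≢u   | no w≢z   = contradiction (ℕ.≤-trans (neighbours-distinct
          ((w≢u ∷ w≢z ∷ []) ∷ ((λ { refl → u∉ (there (here refl)) }) ∷ []) ∷ [] ∷ [])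
          λ { (here refl) → vw ; (there (here refl)) → vu ; (there (there (here refl))) → symm G zv }) (deg≤2 _))
          λ { (s≤s (s≤s ())) }

  extend : ∀ {u us z} → Trail u us → z ∉ˡ u ∷ us → ∃ λ w → Trail w (u ∷ us)
  extend {u} {us} {z} t z∉ with crossing (_∈ˡ? (u ∷ us)) (connected u z) (here refl) z∉
  ... | _ , w , uw , here refl , w∉ = w , step t w∉ uw
  ... | _ , w , aw , there a∈  , w∉ = contradiction (trail-saturated t a∈ aw) w∉

  Hamiltonian : Set
  Hamiltonian = ∃₂ λ u us → Trail u us × ∀ v → v ∈ˡ u ∷ us

  -- Each extension trades one unit of fuel for one vertex, which makes the recursion structural.
  -- Fuel zero is contradictory: the trail would consist of more than `m` distinct vertices.
  grow : ∀ fuel {u us} → Trail u us → m ≤ fuel + length us → Hamiltonian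
  grow fuel {u} {us} t m≤ with Fin.all? (_∈ˡ? (u ∷ us))
  ... | yes all = u , us , t , all
  ... | no ¬all with z , z∉ ← Fin.¬∀⟶∃¬ _ _ (_∈ˡ? (u ∷ us)) ¬all with fuel
  ...   | suc fuel = grow fuel (proj₂ (extend t z∉)) (subst (m ≤_) (sym (ℕ.+-suc fuel (length us))) m≤)
  ...   | zero = contradiction
            (ℕ.≤-trans (ℕ.≤-trans (length≤∣∣ ⊤ (trail-unique t) (λ _ → ∈⊤)) (∣p∣≤n ⊤)) m≤)
            ℕ.1+n≰n

  hamiltonian : Hamiltonian
  hamiltonian = grow m start (ℕ.m≤m+n m 0)

  -- Consecutive entries are adjacent by construction. A chord would join a new tip to a vertex
  -- before the previous tip, and by `trail-saturated` the new tip would then have been visited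
  -- already.
  trail-adj : ∀ {u us} → Trail u us → ∀ i j →
    Adj G (lookup (u ∷ us) i) (lookup (u ∷ us) j) ⇔ Adj (path (suc (length us))) i j
  trail-adj t zero zero = mk⇔ (⊥-elim ∘ irrefl G refl) λ { (inj₁ ()) ; (inj₂ ()) }
  trail-adj (step t _ uw) zero (suc zero) = mk⇔ (λ _ → inj₁ refl) (λ _ → symm G uw)
  trail-adj (step t _ uw) (suc zero) zero = mk⇔ (λ _ → inj₂ refl) (λ _ → uw)
  trail-adj (step t w∉ _) zero (suc (suc j)) = mk⇔
    (λ a → contradiction (trail-saturated t (∈-lookup j) (symm G a)) w∉) λ { (inj₁ ()) ; (inj₂ ()) }
  trail-adj (step t w∉ _) (suc (suc i)) zero = mk⇔
    (λ a → contradiction (trail-saturated t (∈-lookup i) a) w∉) λ { (inj₁ ()) ; (inj₂ ()) }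
  trail-adj (step t _ _) (suc i) (suc j) = mk⇔
    (Sum.map (cong suc) (cong suc) ∘ Equivalence.to (trail-adj t i j))
    (Equivalence.from (trail-adj t i j) ∘ Sum.map ℕ.suc-injective ℕ.suc-injective)

  -- A vertex goes to its index in the trail, counted from the tip. The order of the path is the
  -- number of visited vertices, which equals `m` only propositionally; hence the existential.
  isPath : ∃ λ l → G ≅ path l
  isPath with u , us , t , all ← hamiltonian = suc (length us) , record
    { bijection = mk↔ₛ′ (Any.index ∘ all) (lookup (u ∷ us))
        (λ i → lookup-injective (trail-unique t) _ _ (sym (Any.lookup-index (all (lookup (u ∷ us) i)))))
        (λ v → sym (Any.lookup-index (all v)))
    ; preserves = λ v w → subst₂
        (λ v′ w′ → Adj G v′ w′ ⇔ Adj (path (suc (length us))) (Any.index (all v)) (Any.index (all w)))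
        (sym (Any.lookup-index (all v))) (sym (Any.lookup-index (all w)))
        (trail-adj t (Any.index (all v)) (Any.index (all w)))
    }

-- Recovering the graph from its polynomial

-- The sets of size 1 are the singletons, all of them connected, with f_y = m - deg u by
-- `weight-singleton`. The coefficient of x y^j thus counts the vertices with m - deg u = j.
coeff-da-linear : ∀ {m} (G : Graph m) j →
  coeff (da G) 1 j ≡ sum (map (λ u → term (1 , 1 , m ∸ deg G u) 1 j) (allFin m))
coeff-da-linear {m} G j = begin
  coeff (da G) 1 j
    ≡⟨ coeff-da G 1 j
         (Unique.map⁺ (λ {u} {v} eq → x∈⁅y⁆⇒x≡y v (subst (u ∈_) eq (x∈⁅x⁆ u))) (Unique.allFin⁺ m)) singletons ⟩
  sum (map (λ S → coeff (daTerm G S) 1 j) (map ⁅_⁆ (allFin m)))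
    ≡⟨ cong sum (map-∘ (allFin m)) ⟨
  sum (map (λ u → coeff (daTerm G ⁅ u ⁆) 1 j) (allFin m))
    ≡⟨ cong sum (map-cong summand (allFin m)) ⟩
  _ ∎
  where
  open ≡-Reasoning

  singletons : ∀ {S} → Nonempty S → Connected (Induced G S) → ∣ S ∣ ≡ 1 → S ∈ˡ map ⁅_⁆ (allFin m)
  singletons {S} (u , u∈) _ ∣S∣≡1 = subst (_∈ˡ map ⁅_⁆ (allFin m))
    (⊆-antisym (λ p → subst (_∈ S) (sym (x∈⁅y⁆⇒x≡y u p)) u∈) ⊆⁅u⁆) (∈-map⁺ ⁅_⁆ (∈-allFin u))
    where
    ⊆⁅u⁆ : ∀ {v} → v ∈ S → v ∈ ⁅ u ⁆
    ⊆⁅u⁆ {v} v∈ with v Fin.≟ u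
    ... | yes refl = x∈⁅x⁆ u
    ... | no v≢u   = contradiction (subst (2 ≤_) ∣S∣≡1 (length≤∣∣ S ((v≢u ∷ []) ∷ [] ∷ [])
            λ { (here refl) → v∈ ; (there (here refl)) → u∈ })) λ { (s≤s ()) }

  summand : ∀ u → coeff (daTerm G ⁅ u ⁆) 1 j ≡ term (1 , 1 , m ∸ deg G u) 1 j
  summand u = daTerm≡ G (u , x∈⁅x⁆ u) conn (∣⁅x⁆∣≡1 u)
    (λ ne → f-y≡ G ne
      (λ v∈ → ℕ.≤-reflexive (sym (trans (cong (weight G ⁅ u ⁆) (x∈⁅y⁆⇒x≡y u v∈)) w≡))) (x∈⁅x⁆ u) (ℕ.≤-reflexive w≡))
    1 j
    where
    w≡ : weight G ⁅ u ⁆ u ≡ m ∸ deg G u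
    w≡ = weight-singleton G (x∈⁅y⁆⇒x≡y u)
    conn : Connected (Induced G ⁅ u ⁆)
    conn (v , p) (w , q) with refl ← x∈⁅y⁆⇒x≡y u p with refl ← x∈⁅y⁆⇒x≡y u q with refl ← []=-irrelevant p q = ε

module FromPolynomial (k : ℕ) {m : ℕ} (G : Graph m)
  (coeff≡ : ∀ i j → coeff (da G) i j ≡
    term (2 , 1 , suc k) i j + term (k , 1 , k) i j
      + sum (applyUpTo (λ l → term (k ∸ l + 1 , 2 + l , 2 + k) i j) k)
      + term (1 , 2 + k , 2 + k + 1) i j) where

  linear : ∀ j → sum (map (λ u → term (1 , 1 , m ∸ deg G u) 1 j) (allFin m)) ≡
    term (2 , 1 , suc k) 1 j + term (k , 1 , k) 1 j
  linear j = begin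
    sum (map (λ u → term (1 , 1 , m ∸ deg G u) 1 j) (allFin m))    ≡⟨ coeff-da-linear G j ⟨
    coeff (da G) 1 j                                               ≡⟨ coeff≡ 1 j ⟩
    -- The remaining terms have `x`-exponent `2 + l` or `2 + k`, which is never 1, so they compute
    -- to 0.
    a + b + sum (applyUpTo (λ _ → 0) k) + 0                        ≡⟨ ℕ.+-identityʳ _ ⟩
    a + b + sum (applyUpTo (λ _ → 0) k)                            ≡⟨ cong (a + b +_) (trans (sum-applyUpTo-const 0 k) (ℕ.*-zeroʳ k)) ⟩
    a + b + 0                                                      ≡⟨ ℕ.+-identityʳ _ ⟩
    a + b                                                          ∎
    where
    open ≡-Reasoning
    a b : ℕ
    a = term (2 , 1 , suc k) 1 j
    b = term (k , 1 , k) 1 j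

  off : ∀ c b j → b ≢ j → term (c , 1 , b) 1 j ≡ 0
  off c b j b≢j = decidable-stable (_ ≟ 0) λ ≢0 → b≢j (proj₂ (term-≢0 {c} {1} {b} 1 j ≢0))

  -- The vertex `u` itself adds 1 to the coefficient of x y^j with j = m - deg u, and for any other
  -- j that coefficient is 0 in the formula.
  m∸deg : ∀ u → m ∸ deg G u ≡ suc k ⊎ m ∸ deg G u ≡ k
  m∸deg u with m ∸ deg G u ≟ suc k | m ∸ deg G u ≟ k
  ... | yes p | _     = inj₁ p
  ... | no _  | yes q = inj₂ q
  ... | no ¬p | no ¬q = contradiction (begin
      1                                                ≡⟨ term-refl 1 1 j ⟨
      term (1 , 1 , j) 1 j                             ≤⟨ ∈⇒≤sum (λ u → term (1 , 1 , m ∸ deg G u) 1 j) (∈-allFin u) ⟩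
      sum (map (λ u → term (1 , 1 , m ∸ deg G u) 1 j) (allFin m))   ≡⟨ linear j ⟩
      term (2 , 1 , suc k) 1 j + term (k , 1 , k) 1 j  ≡⟨ cong₂ _+_ (off 2 (suc k) j (¬p ∘ sym)) (off k k j (¬q ∘ sym)) ⟩
      0                                                ∎) λ ()
    where
    open ℕ.≤-Reasoning
    j : ℕ
    j = m ∸ deg G u

  count-leaf : sum (map (λ u → term (1 , 1 , m ∸ deg G u) 1 (suc k)) (allFin m)) ≡ 2
  count-leaf = trans (linear (suc k)) (cong₂ _+_ (term-refl 2 1 (suc k)) (off k k (suc k) (ℕ.<⇒≢ ℕ.≤-refl)))

  count-middle : sum (map (λ u → term (1 , 1 , m ∸ deg G u) 1 k) (allFin m)) ≡ k
  count-middle = trans (linear k) (cong₂ _+_ (off 2 (suc k) k (ℕ.<⇒≢ ℕ.≤-refl ∘ sym)) (term-refl k 1 k))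

  -- By `m∸deg` each vertex is counted in exactly one of the coefficients of x y^(n-1) and x
  -- y^(n-2), which add up to 2 + (n - 2).
  m≡n : m ≡ 2 + k
  m≡n = begin
    m                                                        ≡⟨ length-tabulate id ⟨
    length (allFin m)                                        ≡⟨ sum-map-1 (allFin m) ⟨
    sum (map (λ _ → 1) (allFin m))                           ≡⟨ cong sum (map-cong one (allFin m)) ⟨
    sum (map (λ u → leaf u + middle u) (allFin m))           ≡⟨ sum-map-+ leaf middle (allFin m) ⟩
    sum (map leaf (allFin m)) + sum (map middle (allFin m))  ≡⟨ cong₂ _+_ count-leaf count-middle ⟩
    2 + k                                                    ∎
    where
    open ≡-Reasoning
    leaf middle : Fin m → ℕ
    leaf u   = term (1 , 1 , m ∸ deg G u) 1 (suc k)
    middle u = term (1 , 1 , m ∸ deg G u) 1 k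
    one : ∀ u → leaf u + middle u ≡ 1
    one u with m∸deg u
    ... | inj₁ eq rewrite eq = cong₂ _+_ (term-refl 1 1 (suc k)) (off 1 (suc k) k (ℕ.<⇒≢ ℕ.≤-refl ∘ sym))
    ... | inj₂ eq rewrite eq = cong₂ _+_ (off 1 k (suc k) (ℕ.<⇒≢ ℕ.≤-refl)) (term-refl 1 1 k)

  -- Cancelling `m` in truncated subtraction requires both subtrahends to be at most `m`; for `d`
  -- this follows from m = n, which is at least 2.
  deg-from : ∀ d {u} → d ≤ 2 → m ∸ deg G u ≡ 2 + k ∸ d → deg G u ≡ d
  deg-from d {u} d≤2 eq = ℕ.∸-cancelˡ-≡ (∣p∣≤n (neighbours G u)) (ℕ.≤-trans d≤2 (subst (2 ≤_) (sym m≡n) (ℕ.m≤m+n 2 k)))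
    (trans eq (cong (_∸ d) (sym m≡n)))

  deg≤2 : ∀ u → deg G u ≤ 2
  deg≤2 u with m∸deg u
  ... | inj₁ eq = ℕ.≤-trans (ℕ.≤-reflexive (deg-from 1 (s≤s z≤n) eq)) (s≤s z≤n)
  ... | inj₂ eq = ℕ.≤-reflexive (deg-from 2 ℕ.≤-refl eq)

  leaf : ∃ λ u → deg G u ≡ 1
  leaf with u , ≢0 ← sum≢0⇒∃ (λ u → term (1 , 1 , m ∸ deg G u) 1 (suc k)) (allFin m)
    (λ eq → contradiction (trans (sym count-leaf) eq) λ ()) =
    u , deg-from 1 (s≤s z≤n) (proj₂ (term-≢0 {1} {1} {m ∸ deg G u} 1 (suc k) ≢0))

  -- Coefficients are natural numbers, so the summand 1 at x^n y^(n+1) cannot be cancelled and some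
  -- connected set of n vertices contributes. As m = n, it is the whole vertex set.
  connected : ∀ u v → Star (Adj G) u v
  connected u v = from-subset (sum≢0⇒∃ (λ S → coeff (daTerm G S) (2 + k) (2 + k + 1)) (subsets m)
    λ ≡0 → contradiction (ℕ.≤-trans (ℕ.≤-reflexive (sym (term-refl 1 (2 + k) (2 + k + 1)))) (ℕ.≤-trans (ℕ.m≤n+m _ _)
      (ℕ.≤-reflexive (trans (sym (coeff≡ (2 + k) (2 + k + 1)))
        (trans (coeff-∑ (subsets m) (daTerm G) (2 + k) (2 + k + 1)) ≡0))))) λ ())
    where
    from-subset : (∃ λ S → coeff (daTerm G S) (2 + k) (2 + k + 1) ≢ 0) → Star (Adj G) u v
    from-subset (S , ≢0) with _ , conn , ∣S∣≡ ← daTerm≢0 G S (2 + k) (2 + k + 1) ≢0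
      with refl ← ∣p∣≡n⇒p≡⊤ {p = S} (trans ∣S∣≡ (sym m≡n)) = Star.gmap proj₁ id (conn (u , ∈⊤) (v , ∈⊤))

  isPath : G ≅ path (2 + k)
  isPath = resize (TrailFrom.isPath G (proj₁ leaf) (proj₂ leaf) deg≤2 connected)
    where
    resize : (∃ λ l → G ≅ path l) → G ≅ path (2 + k)
    resize (l , iso) = subst (λ n → G ≅ path n) (trans (sym (↔⇒≡ (_≅_.bijection iso))) m≡n) iso

proposition16 : (n : ℕ) → 2 ≤ n → (m : ℕ) → .{{_ : NonZero m}} → (G : Graph m) →
    (G ≅ path n) ⇔
    (da G ≈ₚ
    const 2 *ₚ x *ₚ y ^ₚ (n ∸ 1)
    +ₚ const (n ∸ 2) *ₚ x *ₚ y ^ₚ (n ∸ 2)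
    +ₚ y ^ₚ n *ₚ ∑ [ 2 ⋯ n ∸ 1 ] (λ i → const (n ∸ i + 1) *ₚ x ^ₚ i)
    +ₚ x ^ₚ n *ₚ y ^ₚ (n + 1))
proposition16 (suc (suc k)) (s≤s (s≤s z≤n)) m G = mk⇔ (forward ∘ λ iso → ↔⇒≡ (_≅_.bijection iso) , iso)
  λ da≈ → FromPolynomial.isPath k G λ i j → trans (da≈ i j) (coeff-path k i j)
  where
  forward : m ≡ 2 + k × G ≅ path (2 + k) → _
  -- An isomorphism forces equal orders; matching on that equality gives `G` the type that
  -- `PathGraph` expects.
  forward (refl , iso) i j = trans (PathGraph.coeff-da-path k G iso i j) (sym (coeff-path k i j))
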